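{- If $S$ and the dimension of $x$ are finite, then there exists a rounding scheme $P$ whose performance ratio equals the integrality gap.
   Context: Setting: $x$ is a non-negative real vector representing a relaxed solution to some problem. $S$ is a set of allowable solutions, each also a nonnegative real vector (indexed by the same coordinates as $x$), and one wants to round $x$ to some $y\in S$. A (randomized) rounding scheme is a probability distribution $P$ on $S$. For a nonnegative weight function $w$ (a nonnegative vector indexed by the same coordinates), the cost of $x$ is $w\cdot x=\sum_i w_ix_i$ and the cost of $y\in S$ is $w\cdot y=\sum_i w_iy_i$. The performance ratio of $P$ is $\sup_w \frac{E_{y\in P}[w\cdot y]}{w\cdot x}$, where $E_{y\in P}$ denotes expectation over $y\in S$ chosen according to $P$. The integrality gap is $\sup_w \frac{\inf_{y\in S} w\cdot y}{w\cdot x}$. Both suprema are over nonnegative weight functions $w$ for which the ratio is defined, i.e. $w\cdot x>0$ (the value $+\infty$ is allowed). -}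

module Defs where

open import Algebra.Bundles using (CommutativeRing)
open import Algebra.Core using (Op₁; Op₂)
open import Algebra.Structures using (IsCommutativeRing)
open import Data.Fin.Base using (Fin)
open import Data.Nat.Base using (ℕ; NonZero)
open import Data.Product.Base using (∃; ∃-syntax; _×_)
open import Data.Vec.Functional using (Vector)
open import Function.Base using (flip)
open import Level using (Level; _⊔_) renaming (suc to lsuc)
open import Relation.Binary.Core using (Rel)
open import Relation.Binary.PropositionalEquality.Core using (_≡_)
open import Relation.Binary.Structures using (IsDecTotalOrder)
open import Relation.Nullary.Construct.Add.Extrema using (_±; [_])
open import Relation.Nullary.Negation.Core using (¬_)
open import Relation.Unary using (Pred)
import Algebra.Properties.CommutativeMonoid.Sum as Sum
import Relation.Binary.Construct.Add.Extrema.NonStrict as AddExtrema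
import Relation.Binary.Construct.NonStrictToStrict as ToStrict

module _ {a ℓ} {A : Set a} (_≤_ : Rel A ℓ) where

  UpperBound : ∀ {p} → Pred A p → Pred A (a ⊔ ℓ ⊔ p)
  UpperBound P u = ∀ r → P r → r ≤ u

  IsSupremum : ∀ {p} → Pred A p → Pred A (a ⊔ ℓ ⊔ p)
  IsSupremum P s = UpperBound P s × (∀ u → UpperBound P u → s ≤ u)

IsInfimum : ∀ {a ℓ p} {A : Set a} → Rel A ℓ → Pred A p → Pred A (a ⊔ ℓ ⊔ p)
IsInfimum _≤_ = IsSupremum (flip _≤_)

-- The real numbers, given by their characterisation (unique up to isomorphism)
-- as a Dedekind-complete ordered field. Decidability of the order expresses
-- that these are the classical reals.
record RealNumbers (c ℓ₁ ℓ₂ : Level) : Set (lsuc (c ⊔ ℓ₁ ⊔ ℓ₂)) where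
  infix  8 _⁻¹ -_
  infixl 7 _*_
  infixl 6 _+_
  infix  4 _≈_ _≤_
  field
    Carrier           : Set c
    _≈_               : Rel Carrier ℓ₁
    _≤_               : Rel Carrier ℓ₂
    _+_ _*_           : Op₂ Carrier
    -_                : Op₁ Carrier
    0# 1#             : Carrier
    isCommutativeRing : IsCommutativeRing _≈_ _+_ _*_ -_ 0# 1#
    0≉1               : ¬ (0# ≈ 1#)
    -- Total for convenience; the value of 0# ⁻¹ is unspecified.
    _⁻¹               : Op₁ Carrier
    ⁻¹-inverseʳ       : ∀ x → ¬ (x ≈ 0#) → x * x ⁻¹ ≈ 1#
    isDecTotalOrder   : IsDecTotalOrder _≈_ _≤_
    +-monoˡ-≤         : ∀ x y z → x ≤ y → x + z ≤ y + z
    *-nonNegative     : ∀ x y → 0# ≤ x → 0# ≤ y → 0# ≤ x * y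
    complete          : (A : Pred Carrier (c ⊔ ℓ₁ ⊔ ℓ₂)) → ∃ A →
                        ∃ (UpperBound _≤_ A) → ∃ (IsSupremum _≤_ A)

  commutativeRing : CommutativeRing c ℓ₁
  commutativeRing = record { isCommutativeRing = isCommutativeRing }

  infixl 7 _÷_
  _÷_ : Op₂ Carrier
  x ÷ y = x * y ⁻¹

  open ToStrict _≈_ _≤_ public using (_<_)
  open AddExtrema _≤_ public using (_≤±_)
  open Sum (CommutativeRing.+-commutativeMonoid commutativeRing) public using (sum)

module Rounding {c ℓ₁ ℓ₂} (ℝ : RealNumbers c ℓ₁ ℓ₂) where
  open RealNumbers ℝ

  NonNegative : ∀ {n} → Pred (Vector Carrier n) ℓ₂
  NonNegative v = ∀ i → 0# ≤ v i

  infix 7 _·_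
  _·_ : ∀ {n} → Vector Carrier n → Vector Carrier n → Carrier
  u · v = sum (λ i → u i * v i)

  -- A finite set is given by an enumeration without repetition. It is nonempty,
  -- as otherwise there is no probability distribution on it.
  record SolutionSet (n : ℕ) : Set (c ⊔ ℓ₁ ⊔ ℓ₂) where
    field
      size            : ℕ
      size-nonZero    : NonZero size
      element         : Fin size → Vector Carrier n
      distinct        : ∀ j k → (∀ i → element j i ≈ element k i) → j ≡ k
      nonNegative     : ∀ j → NonNegative (element j)

  record RoundingScheme {n} (S : SolutionSet n) : Set (c ⊔ ℓ₁ ⊔ ℓ₂) where
    open SolutionSet S
    field
      probability   : Fin size → Carrier
      nonNegative   : NonNegative probability
      normalised    : sum probability ≈ 1#

  𝔼 : ∀ {n} {S : SolutionSet n} → RoundingScheme S → (Vector Carrier n → Carrier) → Carrier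
  𝔼 {S = S} P f = sum (λ j → RoundingScheme.probability P j * f (SolutionSet.element S j))

  Cost : ∀ {n} → SolutionSet n → Vector Carrier n → Pred Carrier c
  Cost S w r = ∃[ j ] r ≡ w · SolutionSet.element S j

  -- Weights for which the ratio to the cost of x is defined.
  Admissible : ∀ {n} → Vector Carrier n → Pred (Vector Carrier n) (ℓ₁ ⊔ ℓ₂)
  Admissible x w = NonNegative w × 0# < w · x

  -- Suprema are taken in the extended reals Carrier ±, so they may be +∞ (and
  -- the supremum is -∞ when x = 0, where no weight is admissible).
  IsPerformanceRatio : ∀ {n} → Vector Carrier n → {S : SolutionSet n} → RoundingScheme S →
                       Pred (Carrier ±) (c ⊔ ℓ₁ ⊔ ℓ₂)
  IsPerformanceRatio x P = IsSupremum _≤±_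
    λ r → ∃[ w ] Admissible x w × r ≡ [ 𝔼 P (λ y → w · y) ÷ (w · x) ]

  IsIntegralityGap : ∀ {n} → Vector Carrier n → SolutionSet n → Pred (Carrier ±) (c ⊔ ℓ₁ ⊔ ℓ₂)
  IsIntegralityGap x S = IsSupremum _≤±_
    λ r → ∃[ w ] Admissible x w × ∃[ m ] IsInfimum _≤_ (Cost S w) m × r ≡ [ m ÷ (w · x) ]

{-# OPTIONS --safe #-}
module Submission where

-- The conditions p ≥ 0, Σⱼ pⱼ = 1, Σⱼ pⱼ yⱼ ≤ ρ x say that p is a rounding scheme
-- of performance ratio at most ρ. Fourier–Motzkin elimination of p leaves finitely
-- many inequalities t ≤ ρ (w · x), each coming from a weight w ≥ 0 with t ≤ w · yⱼ
-- for all j. At the least feasible ρ one of them is an equality, and its w shows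
-- that the gap is at least ρ. If no ρ is feasible, some w has w · x = 0 and t > 0,
-- and the gap is infinite. Since a minimum is at most an average, the gap never
-- exceeds a performance ratio, so the values agree.

open import Defs
open import Algebra.Bundles using (CommutativeRing)
open import Data.Fin.Base using (Fin; zero; suc)
open import Data.List.Base using (List; []; _∷_; _++_; map; filter; cartesianProductWith; allFin)
open import Data.List.Membership.Propositional using (_∈_)
open import Data.List.Relation.Unary.Any using (here; there)
open import Data.List.Membership.Propositional.Properties using (∈-allFin; ∈-filter⁺; ∈-filter⁻; ∈-map⁺; ∈-++⁺ˡ; ∈-++⁺ʳ; ∈-cartesianProductWith⁺)
open import Data.List.Relation.Unary.All as All using (All; []; _∷_)
open import Data.List.Relation.Unary.All.Properties as Allₚ using ()
open import Data.Nat.Base using (ℕ; zero; suc; NonZero)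
open import Data.Product.Base using (Σ-syntax; ∃; _×_; _,_; proj₁; proj₂)
open import Data.Sum.Base using (_⊎_; inj₁; inj₂)
open import Data.Vec.Functional as Vector using (Vector; head; tail)
open import Function.Base using (_∘_)
open import Level using (Level; _⊔_)
open import Relation.Binary.Bundles using (DecTotalOrder; StrictTotalOrder)
open import Relation.Binary.Definitions using (tri<; tri≈; tri>)
open import Relation.Binary.PropositionalEquality.Core as ≡ using (_≡_)
open import Relation.Binary.PropositionalEquality.Properties using (setoid)
open import Relation.Nullary.Construct.Add.Extrema using (_±; [_]; ⊥±; ⊤±)
open import Relation.Nullary.Decidable.Core using (yes; no)
open import Relation.Nullary.Negation.Core using (¬_; contradiction)
open import Relation.Unary using (Pred)
import Algebra.Properties.Ring as RingProperties
import Algebra.Properties.Semiring.Sum as SumProperties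
import Algebra.Solver.Ring.NaturalCoefficients.Default as Solver
import Relation.Binary.Construct.Add.Extrema.NonStrict as Extrema
import Relation.Binary.Construct.Add.Supremum.NonStrict as Supremum
import Relation.Binary.Properties.DecTotalOrder as DecTotalOrderProperties
import Relation.Binary.Properties.Poset as PosetProperties
import Relation.Binary.Reasoning.PartialOrder as PartialOrderReasoning

-- Arithmetic and order in a totally ordered field.

module OrderedField {c ℓ₁ ℓ₂} (ℝ : RealNumbers c ℓ₁ ℓ₂) where
  open RealNumbers ℝ public
  open Rounding ℝ public using (NonNegative; _·_)
  open CommutativeRing commutativeRing public
    using (refl; sym; trans; +-cong; +-congˡ; +-congʳ; *-congˡ; *-congʳ; -‿cong;
           +-assoc; +-comm; +-identityˡ; +-identityʳ; -‿inverseˡ; -‿inverseʳ;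
           *-assoc; *-comm; *-identityˡ; *-identityʳ; zeroˡ; zeroʳ; distribˡ; distribʳ;
           semiring; ring; commutativeSemiring)
  open RingProperties ring public using (+-inverseˡ-unique; -1*x≈-x; -‿distribˡ-*; -‿distribʳ-*)
  open SumProperties semiring public
    using (sum-cong-≋; ∑-distrib-+; ∑-comm; *-distribˡ-sum; *-distribʳ-sum)
  open Solver commutativeSemiring public using (solve; _:+_; _:*_; _:=_)

  decTotalOrder : DecTotalOrder c ℓ₁ ℓ₂
  decTotalOrder = record { isDecTotalOrder = isDecTotalOrder }

  open DecTotalOrder decTotalOrder public using (poset; total; _≤?_; _≟_; ≤-respˡ-≈; ≤-respʳ-≈)
    renaming (reflexive to ≤-reflexive; refl to ≤-refl; trans to ≤-trans; antisym to ≤-antisym)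
  open DecTotalOrderProperties decTotalOrder public using (≮⇒≥; <-strictTotalOrder)
  open PosetProperties poset public using (<⇒≱)
  open StrictTotalOrder <-strictTotalOrder public using (compare; _<?_; <-respʳ-≈)
  open PartialOrderReasoning poset public

  ≰⇒> : ∀ {x y} → ¬ (x ≤ y) → y < x
  ≰⇒> {x} {y} x≰y with total x y
  ... | inj₁ x≤y = contradiction x≤y x≰y
  ... | inj₂ y≤x = y≤x , λ y≈x → x≰y (≤-reflexive (sym y≈x))

  +-mono-≤ : ∀ {u v x y} → u ≤ v → x ≤ y → u + x ≤ v + y
  +-mono-≤ {u} {v} {x} {y} u≤v x≤y = begin
    u + x ≤⟨ +-monoˡ-≤ u v x u≤v ⟩
    v + x ≈⟨ +-comm v x ⟩
    x + v ≤⟨ +-monoˡ-≤ x y v x≤y ⟩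
    y + v ≈⟨ +-comm y v ⟩
    v + y ∎

  0≤+ : ∀ {x y} → 0# ≤ x → 0# ≤ y → 0# ≤ x + y
  0≤+ 0≤x 0≤y = ≤-respˡ-≈ (+-identityˡ 0#) (+-mono-≤ 0≤x 0≤y)

  +-cancelʳ-≤ : ∀ z {x y} → x + z ≤ y + z → x ≤ y
  +-cancelʳ-≤ z {x} {y} x+z≤y+z = begin
    x             ≈⟨ cancel x ⟨
    x + z + (- z) ≤⟨ +-monoˡ-≤ _ _ (- z) x+z≤y+z ⟩
    y + z + (- z) ≈⟨ cancel y ⟩
    y             ∎
    where
    cancel : ∀ u → u + z + (- z) ≈ u
    cancel u = trans (+-assoc u z (- z)) (trans (+-congˡ (-‿inverseʳ z)) (+-identityʳ u))

  x≤y⇒0≤y-x : ∀ {x y} → x ≤ y → 0# ≤ y + (- x)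
  x≤y⇒0≤y-x {x} {y} x≤y = ≤-respˡ-≈ (-‿inverseʳ x) (+-monoˡ-≤ x y (- x) x≤y)

  0≤y-x⇒x≤y : ∀ {x y} → 0# ≤ y + (- x) → x ≤ y
  0≤y-x⇒x≤y {x} {y} 0≤y-x = +-cancelʳ-≤ (- x) (≤-respˡ-≈ (sym (-‿inverseʳ x)) 0≤y-x)

  x≤0⇒0≤-x : ∀ {x} → x ≤ 0# → 0# ≤ - x
  x≤0⇒0≤-x {x} x≤0 = ≤-respʳ-≈ (+-identityˡ (- x)) (x≤y⇒0≤y-x x≤0)

  x<0⇒0<-x : ∀ {x} → x < 0# → 0# < - x
  x<0⇒0<-x {x} (x≤0 , x≉0) = x≤0⇒0≤-x x≤0 , λ 0≈-x → x≉0 (begin-equality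
    x         ≈⟨ +-identityʳ x ⟨
    x + 0#    ≈⟨ +-congˡ 0≈-x ⟩
    x + (- x) ≈⟨ -‿inverseʳ x ⟩
    0#        ∎)

  *-monoʳ-≤ : ∀ {a x y} → 0# ≤ a → x ≤ y → a * x ≤ a * y
  *-monoʳ-≤ {a} {x} {y} 0≤a x≤y = 0≤y-x⇒x≤y (begin
    0#                  ≤⟨ *-nonNegative a (y + (- x)) 0≤a (x≤y⇒0≤y-x x≤y) ⟩
    a * (y + (- x))     ≈⟨ distribˡ a y (- x) ⟩
    a * y + a * (- x)   ≈⟨ +-congˡ (-‿distribʳ-* a x) ⟨
    a * y + (- (a * x)) ∎)

  *-antimonoʳ-≤ : ∀ {a x y} → a ≤ 0# → x ≤ y → a * y ≤ a * x
  *-antimonoʳ-≤ {a} {x} {y} a≤0 x≤y = +-cancelʳ-≤ (- a * x) (begin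
    a * y + - a * x ≤⟨ +-mono-≤ ≤-refl (*-monoʳ-≤ (x≤0⇒0≤-x a≤0) x≤y) ⟩
    a * y + - a * y ≈⟨ vanish y ⟩
    0#              ≈⟨ vanish x ⟨
    a * x + - a * x ∎)
    where
    vanish : ∀ z → a * z + - a * z ≈ 0#
    vanish z = trans (sym (distribʳ z a (- a))) (trans (*-congʳ (-‿inverseʳ a)) (zeroˡ z))

  *-monoˡ-≤ : ∀ {a x y} → 0# ≤ a → x ≤ y → x * a ≤ y * a
  *-monoˡ-≤ {a} {x} {y} 0≤a x≤y = begin
    x * a ≈⟨ *-comm x a ⟩
    a * x ≤⟨ *-monoʳ-≤ 0≤a x≤y ⟩
    a * y ≈⟨ *-comm a y ⟩
    y * a ∎

  1≰0 : ¬ (1# ≤ 0#)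
  1≰0 1≤0 = 0≉1 (≤-antisym 0≤1 1≤0)
    where
    0≤1 : 0# ≤ 1#
    0≤1 = begin
      0#       ≈⟨ zeroʳ 1# ⟨
      -- The assumption `1# ≤ 0#` is used twice: as the inequality, and as the sign of the factor
      -- `1#` that reverses it.
      1# * 0#  ≤⟨ *-antimonoʳ-≤ 1≤0 1≤0 ⟩
      1# * 1#  ≈⟨ *-identityʳ 1# ⟩
      1#       ∎

  0≤1 : 0# ≤ 1#
  0≤1 with total 0# 1#
  ... | inj₁ 0≤1 = 0≤1
  ... | inj₂ 1≤0 = contradiction 1≤0 1≰0

  >⇒≉ : ∀ {x} → 0# < x → ¬ (x ≈ 0#)
  >⇒≉ (_ , 0≉x) x≈0 = 0≉x (sym x≈0)

  0≤x⁻¹ : ∀ {x} → 0# < x → 0# ≤ x ⁻¹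
  0≤x⁻¹ {x} 0<x with total 0# (x ⁻¹)
  ... | inj₁ 0≤x⁻¹ = 0≤x⁻¹
  ... | inj₂ x⁻¹≤0 = contradiction 1≤0 1≰0
    where
    1≤0 : 1# ≤ 0#
    1≤0 = begin
      1#       ≈⟨ ⁻¹-inverseʳ x (>⇒≉ 0<x) ⟨
      x * x ⁻¹ ≤⟨ *-monoʳ-≤ (proj₁ 0<x) x⁻¹≤0 ⟩
      x * 0#   ≈⟨ zeroʳ x ⟩
      0#       ∎

  [x*a]÷a≈x : ∀ {a} x → 0# < a → (x * a) ÷ a ≈ x
  [x*a]÷a≈x {a} x 0<a = trans (*-assoc x a (a ⁻¹))
    (trans (*-congˡ (⁻¹-inverseʳ a (>⇒≉ 0<a))) (*-identityʳ x))

  ÷-mono-≤ : ∀ {a x y} → 0# < a → x ≤ y → x ÷ a ≤ y ÷ a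
  ÷-mono-≤ 0<a = *-monoˡ-≤ (0≤x⁻¹ 0<a)

  x*a≤y⇒x≤y÷a : ∀ {a x y} → 0# < a → x * a ≤ y → x ≤ y ÷ a
  x*a≤y⇒x≤y÷a 0<a x*a≤y = ≤-respˡ-≈ ([x*a]÷a≈x _ 0<a) (÷-mono-≤ 0<a x*a≤y)

  x≤y*a⇒x÷a≤y : ∀ {a x y} → 0# < a → x ≤ y * a → x ÷ a ≤ y
  x≤y*a⇒x÷a≤y 0<a x≤y*a = ≤-respʳ-≈ ([x*a]÷a≈x _ 0<a) (÷-mono-≤ 0<a x≤y*a)

  *-cancelˡ-≤ : ∀ {a x y} → 0# < a → a * x ≤ a * y → x ≤ y
  *-cancelˡ-≤ {a} {x} {y} 0<a ax≤ay = ≤-respʳ-≈ ([x*a]÷a≈x y 0<a)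
    (x*a≤y⇒x≤y÷a 0<a (≤-respˡ-≈ (*-comm a x) (≤-respʳ-≈ (*-comm a y) ax≤ay)))

  *-cancelˡ-≤-neg : ∀ {a x y} → a < 0# → a * x ≤ a * y → y ≤ x
  *-cancelˡ-≤-neg {a} {x} {y} a<0 ax≤ay = *-cancelˡ-≤ (x<0⇒0<-x a<0) (+-cancelʳ-≤ (a * x) (begin
    - a * y + a * x ≤⟨ +-mono-≤ ≤-refl ax≤ay ⟩
    - a * y + a * y ≈⟨ vanish y ⟩
    0#              ≈⟨ vanish x ⟨
    - a * x + a * x ∎))
    where
    vanish : ∀ z → - a * z + a * z ≈ 0#
    vanish z = trans (sym (distribʳ z (- a) a)) (trans (*-congʳ (-‿inverseˡ a)) (zeroˡ z))

  linear-root : ∀ a b → ¬ (a ≈ 0#) → ∃ λ t → a * t + b ≈ 0#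
  linear-root a b a≉0 = a ⁻¹ * (- b) , (begin-equality
    a * (a ⁻¹ * (- b)) + b ≈⟨ +-congʳ (*-assoc a (a ⁻¹) (- b)) ⟨
    a * a ⁻¹ * (- b) + b   ≈⟨ +-congʳ (*-congʳ (⁻¹-inverseʳ a a≉0)) ⟩
    1# * (- b) + b         ≈⟨ +-congʳ (*-identityˡ (- b)) ⟩
    - b + b                ≈⟨ -‿inverseˡ b ⟩
    0#                     ∎)

  -- Finite sums, dot products and unit vectors.

  sum-mono-≤ : ∀ {n} {u v : Vector Carrier n} → (∀ i → u i ≤ v i) → sum u ≤ sum v
  sum-mono-≤ {zero}  u≤v = ≤-refl
  sum-mono-≤ {suc n} u≤v = +-mono-≤ (u≤v zero) (sum-mono-≤ (u≤v ∘ suc))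

  ·-monoʳ-≤ : ∀ {n} {w : Vector Carrier n} → NonNegative w →
              ∀ {u v} → (∀ i → u i ≤ v i) → w · u ≤ w · v
  ·-monoʳ-≤ 0≤w u≤v = sum-mono-≤ (λ i → *-monoʳ-≤ (0≤w i) (u≤v i))

  ·-zeroʳ : ∀ {n} (w : Vector Carrier n) → w · (λ _ → 0#) ≈ 0#
  ·-zeroʳ w = trans (sym (*-distribʳ-sum 0# w)) (zeroʳ (sum w))

  ·-zeroˡ : ∀ {n} (w : Vector Carrier n) → (λ _ → 0#) · w ≈ 0#
  ·-zeroˡ w = trans (sym (*-distribˡ-sum 0# w)) (zeroˡ (sum w))

  0≤· : ∀ {n} {u v : Vector Carrier n} → NonNegative u → NonNegative v → 0# ≤ u · v
  0≤· {u = u} 0≤u 0≤v = ≤-respˡ-≈ (·-zeroʳ u) (·-monoʳ-≤ 0≤u 0≤v)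

  combination : ∀ {n} → Carrier → Vector Carrier n → Carrier → Vector Carrier n → Vector Carrier n
  combination a u b v i = a * u i + b * v i

  ·-combination : ∀ {n} a (u : Vector Carrier n) b v p →
                  combination a u b v · p ≈ a * (u · p) + b * (v · p)
  ·-combination a u b v p = begin-equality
    combination a u b v · p                             ≈⟨ sum-cong-≋ (λ i → expand (u i) (v i) (p i)) ⟩
    sum (λ i → a * (u i * p i) + b * (v i * p i))       ≈⟨ ∑-distrib-+ (λ i → a * (u i * p i)) (λ i → b * (v i * p i)) ⟩
    sum (λ i → a * (u i * p i)) + sum (λ i → b * (v i * p i))
      ≈⟨ +-cong (*-distribˡ-sum a (λ i → u i * p i)) (*-distribˡ-sum b (λ i → v i * p i)) ⟨
    a * (u · p) + b * (v · p)                           ∎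
    where
    expand : ∀ x y z → (a * x + b * y) * z ≈ a * (x * z) + b * (y * z)
    expand = solve 5 (λ a b x y z → (a :* x :+ b :* y) :* z := a :* (x :* z) :+ b :* (y :* z)) refl a b

  unit : ∀ {n} → Fin n → Vector Carrier n
  unit zero    zero    = 1#
  unit zero    (suc _) = 0#
  unit (suc _) zero    = 0#
  unit (suc i) (suc j) = unit i j

  0≤unit : ∀ {n} (i : Fin n) → NonNegative (unit i)
  0≤unit zero    zero    = 0≤1
  0≤unit zero    (suc _) = ≤-refl
  0≤unit (suc _) zero    = ≤-refl
  0≤unit (suc i) (suc j) = 0≤unit i j

  unit≤1 : ∀ {n} (i j : Fin n) → unit i j ≤ 1#
  unit≤1 zero    zero    = ≤-refl
  unit≤1 zero    (suc _) = 0≤1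
  unit≤1 (suc _) zero    = 0≤1
  unit≤1 (suc i) (suc j) = unit≤1 i j

  unit-· : ∀ {n} (i : Fin n) v → unit i · v ≈ v i
  unit-· zero    v = trans (+-cong (*-identityˡ (v zero)) (·-zeroˡ (tail v))) (+-identityʳ (v zero))
  unit-· (suc i) v = trans (+-cong (zeroˡ (v zero)) (unit-· i (tail v))) (+-identityˡ (v (suc i)))

  entry≤ones· : ∀ {n} {v : Vector Carrier n} → NonNegative v → ∀ i → v i ≤ (λ _ → 1#) · v
  entry≤ones· {v = v} 0≤v i = ≤-respˡ-≈ (unit-· i v) (sum-mono-≤ λ j → *-monoˡ-≤ (0≤v j) (unit≤1 i j))

  minimum : ∀ {n} → NonZero n → (f : Vector Carrier n) → ∃ λ j → ∀ i → f j ≤ f i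
  minimum {suc zero}    _ f = zero , λ { zero → ≤-refl }
  minimum {suc (suc n)} _ f with minimum _ (tail f)
  ... | j , fj≤ with total (f zero) (f (suc j))
  ...   | inj₁ f0≤fj = zero , λ { zero → ≤-refl ; (suc i) → ≤-trans f0≤fj (fj≤ i) }
  ...   | inj₂ fj≤f0 = suc j , λ { zero → fj≤f0 ; (suc i) → fj≤ i }

-- Fourier-Motzkin elimination.

module FourierMotzkin {c ℓ₁ ℓ₂} (ℝ : RealNumbers c ℓ₁ ℓ₂) where
  open OrderedField ℝ

  -- Given a solution t₀ of the remaining inequalities, either t₀ satisfies the
  -- new one or it is moved exactly to the root of the new one.
  one-variable : ∀ {a} {A : Set a} (α β : A → Carrier) (L : List A) →
    (∀ {u} → u ∈ L → α u ≈ 0# → 0# ≤ β u) →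
    (∀ {u v} → u ∈ L → v ∈ L → 0# < α u → α v < 0# → 0# ≤ α u * β v + (- α v) * β u) →
    ∃ λ t → All (λ u → 0# ≤ α u * t + β u) L
  one-variable α β []      _        _        = 0# , []
  one-variable α β (u ∷ L) constant opposite
    with one-variable α β L (constant ∘ there) (λ u∈L v∈L → opposite (there u∈L) (there v∈L))
  ... | t₀ , t₀-solves with total 0# (α u * t₀ + β u)
  ...   | inj₁ holds = t₀ , holds ∷ t₀-solves
  ...   | inj₂ fails with compare 0# (α u)
  ...     | tri≈ _ 0≈αu _ = t₀ , (begin
              0#             ≤⟨ constant (here ≡.refl) (sym 0≈αu) ⟩
              β u            ≈⟨ +-identityˡ (β u) ⟨
              0# + β u       ≈⟨ +-congʳ (trans (*-congʳ (sym 0≈αu)) (zeroˡ t₀)) ⟨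
              α u * t₀ + β u ∎) ∷ t₀-solves
  -- The new inequality is a lower bound that `t₀` misses, so its root lies to the right of `t₀`.
  ...     | tri< 0<αu _ _ = t , ≤-reflexive (sym root) ∷ All.tabulate solves
    where
    t    = proj₁ (linear-root (α u) (β u) (>⇒≉ 0<αu))
    root = proj₂ (linear-root (α u) (β u) (>⇒≉ 0<αu))
    t₀≤t : t₀ ≤ t
    t₀≤t = *-cancelˡ-≤ 0<αu (+-cancelʳ-≤ (β u) (≤-trans fails (≤-reflexive (sym root))))
    solves : ∀ {v} → v ∈ L → 0# ≤ α v * t + β v
    solves {v} v∈L with 0# ≤? α v
    ... | yes 0≤αv = ≤-trans (All.lookup t₀-solves v∈L) (+-monoˡ-≤ _ _ (β v) (*-monoʳ-≤ 0≤αv t₀≤t))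
    -- An upper bound could break when moving right. Scaled by `α u`, its value at `t` is the
    -- combination in `opposite` plus `α v` times the left side of the root equation, which is zero.
    ... | no  0≰αv = *-cancelˡ-≤ 0<αu (begin
      α u * 0#                                                  ≈⟨ zeroʳ (α u) ⟩
      0#                                                        ≤⟨ opposite (here ≡.refl) (there v∈L) 0<αu (≰⇒> 0≰αv) ⟩
      α u * β v + (- α v) * β u                                 ≈⟨ +-identityˡ _ ⟨
      0# + (α u * β v + (- α v) * β u)                          ≈⟨ +-congʳ (trans (*-congˡ root) (zeroʳ (α v))) ⟨
      α v * (α u * t + β u) + (α u * β v + (- α v) * β u)       ≈⟨ regroup (α u) (β u) (α v) (β v) (- α v) t ⟩
      α u * (α v * t + β v) + (α v + (- α v)) * β u             ≈⟨ +-congˡ (trans (*-congʳ (-‿inverseʳ (α v))) (zeroˡ (β u))) ⟩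
      α u * (α v * t + β v) + 0#                                ≈⟨ +-identityʳ _ ⟩
      α u * (α v * t + β v)                                     ∎)
      where
      regroup : ∀ a b a′ b′ n t → a′ * (a * t + b) + (a * b′ + n * b) ≈ a * (a′ * t + b′) + (a′ + n) * b
      regroup = solve 6 (λ a b a′ b′ n t → a′ :* (a :* t :+ b) :+ (a :* b′ :+ n :* b) := a :* (a′ :* t :+ b′) :+ (a′ :+ n) :* b) refl
  -- Mirror image: the new inequality is an upper bound, the root lies to the left of `t₀`, and the
  -- lower bounds are the ones in danger.
  ...     | tri> _ _ αu<0 = t , ≤-reflexive (sym root) ∷ All.tabulate solves
    where
    t    = proj₁ (linear-root (α u) (β u) (proj₂ αu<0))
    root = proj₂ (linear-root (α u) (β u) (proj₂ αu<0))
    t≤t₀ : t ≤ t₀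
    t≤t₀ = *-cancelˡ-≤-neg αu<0 (+-cancelʳ-≤ (β u) (≤-trans fails (≤-reflexive (sym root))))
    solves : ∀ {v} → v ∈ L → 0# ≤ α v * t + β v
    solves {v} v∈L with 0# <? α v
    ... | no  0≮αv = ≤-trans (All.lookup t₀-solves v∈L) (+-monoˡ-≤ _ _ (β v) (*-antimonoʳ-≤ (≮⇒≥ 0≮αv) t≤t₀))
    ... | yes 0<αv = *-cancelˡ-≤ (x<0⇒0<-x αu<0) (begin
      - α u * 0#                                                ≈⟨ zeroʳ (- α u) ⟩
      0#                                                        ≤⟨ opposite (there v∈L) (here ≡.refl) 0<αv αu<0 ⟩
      α v * β u + (- α u) * β v                                 ≈⟨ +-identityʳ _ ⟨
      α v * β u + (- α u) * β v + 0#                            ≈⟨ +-congˡ (trans (*-congʳ (-‿inverseʳ (α u))) (zeroˡ _)) ⟨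
      α v * β u + (- α u) * β v + (α u + (- α u)) * (α v * t)   ≈⟨ regroup (α u) (β u) (α v) (β v) (- α u) t ⟩
      - α u * (α v * t + β v) + α v * (α u * t + β u)           ≈⟨ +-congˡ (trans (*-congˡ root) (zeroʳ (α v))) ⟩
      - α u * (α v * t + β v) + 0#                              ≈⟨ +-identityʳ _ ⟩
      - α u * (α v * t + β v)                                   ∎)
      where
      regroup : ∀ a b a′ b′ n t → a′ * b + n * b′ + (a + n) * (a′ * t) ≈ n * (a′ * t + b′) + a′ * (a * t + b)
      regroup = solve 6 (λ a b a′ b′ n t → a′ :* b :+ n :* b′ :+ (a :+ n) :* (a′ :* t) := n :* (a′ :* t :+ b′) :+ a′ :* (a :* t :+ b)) refl

  -- The inequality 0 ≤ v · p + b · z in the unknowns p, with parameters z.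
  Inequality : ℕ → ℕ → Set c
  Inequality m e = Vector Carrier m × Vector Carrier e

  module _ {m e : ℕ} where

    infix 4 _⊨_
    _⊨_ : Vector Carrier m × Vector Carrier e → Pred (Inequality m e) ℓ₂
    (p , z) ⊨ (v , b) = 0# ≤ v · p + b · z

    -- `w` need only agree pointwise with the combination, so a cone is also invariant under
    -- pointwise `_≈_`.
    IsConvexCone : ∀ {k} → Pred (Inequality m e) k → Set (c ⊔ ℓ₁ ⊔ ℓ₂ ⊔ k)
    IsConvexCone K = ∀ {α β u v w} → 0# ≤ α → 0# ≤ β → K u → K v →
      (∀ i → proj₁ w i ≈ combination α (proj₁ u) β (proj₁ v) i) →
      (∀ i → proj₂ w i ≈ combination α (proj₂ u) β (proj₂ v) i) → K w

    resp-≈ : ∀ {k} {K : Pred (Inequality m e) k} → IsConvexCone K → ∀ {v v′ b} → (∀ i → v′ i ≈ v i) → K (v , b) → K (v′ , b)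
    resp-≈ cone {v} {v′} {b} v′≈v Kvb = cone {u = v , b} {v , b} {v′ , b} 0≤1 ≤-refl Kvb Kvb
      (λ i → trans (v′≈v i) (sym (1x+0x≈x (v i)))) (λ i → sym (1x+0x≈x (b i)))
      where
      1x+0x≈x : ∀ x → 1# * x + 0# * x ≈ x
      1x+0x≈x x = trans (+-cong (*-identityˡ x) (zeroˡ x)) (+-identityʳ x)

  -- Elimination of one unknown, then of all unknowns.

  module _ {m e : ℕ} where

    lead : Inequality (suc m) e → Carrier
    lead (v , _) = head v

    rest : Inequality (suc m) e → Inequality m e
    rest (v , b) = tail v , b

    -- The combination of `v` with factor `lead u` and `u` with factor `- lead v`, in which the
    -- first unknown drops out. Both factors are positive when `lead u` is positive and `lead v`
    -- negative.
    cancel : Inequality (suc m) e → Inequality (suc m) e → Inequality m e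
    cancel u v = combination (lead u) (tail (proj₁ v)) (- lead v) (tail (proj₁ u))
               , combination (lead u) (proj₂ v) (- lead v) (proj₂ u)

    zeros positives negatives : List (Inequality (suc m) e) → List (Inequality (suc m) e)
    zeros     = filter (λ u → lead u ≟ 0#)
    positives = filter (λ u → 0# <? lead u)
    negatives = filter (λ u → lead u <? 0#)

    eliminate-head : List (Inequality (suc m) e) → List (Inequality m e)
    eliminate-head L = map rest (zeros L) ++ cartesianProductWith cancel (positives L) (negatives L)

    -- With coefficient 0 restored for the eliminated unknown, each new inequality is an old one or
    -- a nonnegative combination of two old ones.
    eliminate-head-∈ : ∀ {k} {K : Pred (Inequality (suc m) e) k} → IsConvexCone K → ∀ {L} → All K L →
                       All (λ u → K ((0# Vector.∷ proj₁ u) , proj₂ u)) (eliminate-head L)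
    eliminate-head-∈ cone {L} L⊆K = Allₚ.++⁺
      (Allₚ.map⁺ (All.tabulate λ u∈ →
        let (u∈L , u≈0) = ∈-filter⁻ _ u∈
        in resp-≈ cone (λ { zero → sym u≈0 ; (suc i) → refl }) (All.lookup L⊆K u∈L)))
      (Allₚ.cartesianProductWith⁺ (setoid _) (setoid _) cancel (positives L) (negatives L) λ {u} {v} u∈ v∈ →
        let (u∈L , 0<u) = ∈-filter⁻ (λ u → 0# <? lead u) u∈
            (v∈L , v<0) = ∈-filter⁻ (λ u → lead u <? 0#) v∈
        in cone (proj₁ 0<u) (x≤0⇒0≤-x (proj₁ v<0)) (All.lookup L⊆K v∈L) (All.lookup L⊆K u∈L)
             (λ { zero → sym (vanish (lead u) (lead v)) ; (suc i) → refl }) (λ i → refl))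
      where
      vanish : ∀ a b → a * b + (- b) * a ≈ 0#
      vanish a b = trans (+-cong (*-comm a b) refl) (trans (sym (distribʳ a b (- b))) (trans (*-congʳ (-‿inverseʳ b)) (zeroˡ a)))

    -- Once `p` and `z` are fixed, every inequality in `L` is affine in `t` with slope `lead u` and
    -- constant `β u`. The inequalities kept by `eliminate-head` are then the hypotheses of
    -- `one-variable`.
    solve-head : ∀ L p z → All ((p , z) ⊨_) (eliminate-head L) → ∃ λ t → All (((t Vector.∷ p) , z) ⊨_) L
    solve-head L p z p-solves = t
      , All.map (λ {u} → ≤-respʳ-≈ (sym (+-assoc (lead u * t) (tail (proj₁ u) · p) (proj₂ u · z)))) (proj₂ solution)
      where
      β : Inequality (suc m) e → Carrier
      β u = tail (proj₁ u) · p + proj₂ u · z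
      constant : ∀ {u} → u ∈ L → lead u ≈ 0# → 0# ≤ β u
      constant u∈L u≈0 = All.lookup p-solves (∈-++⁺ˡ (∈-map⁺ rest (∈-filter⁺ _ u∈L u≈0)))
      opposite : ∀ {u v} → u ∈ L → v ∈ L → 0# < lead u → lead v < 0# → 0# ≤ lead u * β v + (- lead v) * β u
      opposite {u} {v} u∈L v∈L 0<u v<0 = ≤-respʳ-≈
        (trans (+-cong (·-combination (lead u) (tail (proj₁ v)) (- lead v) (tail (proj₁ u)) p)
                       (·-combination (lead u) (proj₂ v) (- lead v) (proj₂ u) z))
               (regroup (lead u) (- lead v) _ _ _ _))
        (All.lookup p-solves (∈-++⁺ʳ (map rest (zeros L))
          (∈-cartesianProductWith⁺ cancel (∈-filter⁺ _ u∈L 0<u) (∈-filter⁺ _ v∈L v<0))))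
        where
        regroup : ∀ a b x y x′ y′ → a * x + b * y + (a * x′ + b * y′) ≈ a * (x + x′) + b * (y + y′)
        regroup = solve 6 (λ a b x y x′ y′ → a :* x :+ b :* y :+ (a :* x′ :+ b :* y′) := a :* (x :+ x′) :+ b :* (y :+ y′)) refl
      solution = one-variable lead β L constant opposite
      t = proj₁ solution

  -- Induction on the number of unknowns. The cone `K` replaces a record of the multipliers:
  -- whatever property nonnegative combinations preserve is inherited by the inequalities that
  -- remain on `z` alone.
  eliminate : ∀ {m e k} {K : Pred (Inequality m e) k} → IsConvexCone K → ∀ {L} → All K L →
    ∃ λ (M : List (Vector Carrier e)) →
      All (λ b → K ((λ _ → 0#) , b)) M ×
      (∀ z → All (λ b → 0# ≤ b · z) M → ∃ λ p → All ((p , z) ⊨_) L)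
  eliminate {zero} cone {L} L⊆K = map proj₂ L
    , Allₚ.map⁺ (All.map (resp-≈ cone λ ()) L⊆K)
    , λ z solves → (λ ()) , All.map (≤-respʳ-≈ (sym (+-identityˡ _))) (Allₚ.map⁻ solves)
  eliminate {suc m} {K = K} cone {L} L⊆K
    -- The slice of `K` where the first coefficient is 0 is again a convex cone, in one unknown
    -- fewer.
    with eliminate {K = λ u → K ((0# Vector.∷ proj₁ u) , proj₂ u)} cone′ (eliminate-head-∈ cone L⊆K)
    where
    cone′ : IsConvexCone (λ u → K ((0# Vector.∷ proj₁ u) , proj₂ u))
    cone′ {α} {β} 0≤α 0≤β Ku Kv eq₁ eq₂ = cone 0≤α 0≤β Ku Kv
      (λ { zero → sym (trans (+-cong (zeroʳ α) (zeroʳ β)) (+-identityˡ 0#)) ; (suc i) → eq₁ i }) eq₂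
  ... | M , M⊆K , extend = M
    , All.map (resp-≈ cone (λ { zero → refl ; (suc i) → refl })) M⊆K
    , λ z solves → let (p , p-solves) = extend z solves
                       (t , t-solves) = solve-head L p z p-solves
                   in t Vector.∷ p , t-solves

-- The least feasible parameter of a system of affine inequalities.

module Game {c ℓ₁ ℓ₂} (ℝ : RealNumbers c ℓ₁ ℓ₂) where
  open OrderedField ℝ
  open FourierMotzkin ℝ

  -- The second parameter is fixed to 1, so `b` encodes the affine function of `ρ` with slope
  -- `b zero` and constant term `b (suc zero)`.
  affine : Carrier → Vector Carrier 2
  affine ρ zero    = ρ
  affine ρ (suc _) = 1#

  ·-affine : ∀ b ρ → b · affine ρ ≈ b zero * ρ + b (suc zero)
  ·-affine b ρ = +-congˡ (trans (+-identityʳ _) (*-identityʳ _))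

  -- All slopes are nonnegative, so raising `ρ` never breaks an inequality. The list is processed
  -- with `ρ` always at the root of some member of `Q`, raised to the new root whenever an
  -- inequality of positive slope fails. For the empty list the root of `b₀` serves.
  least-parameter : ∀ {q} {Q : Pred (Vector Carrier 2) q} → (∀ {b} → Q b → 0# ≤ b zero) →
    ∀ {b₀} → Q b₀ → 0# < b₀ zero → ∀ {M} → All Q M →
    (∃ λ b → Q b × b zero ≤ 0# × b (suc zero) < 0#) ⊎
    (∃ λ ρ → All (λ b → 0# ≤ b · affine ρ) M × ∃ λ b → Q b × 0# < b zero × b zero * ρ + b (suc zero) ≈ 0#)
  least-parameter 0≤Q {b₀} Qb₀ 0<b₀ [] with linear-root (b₀ zero) (b₀ (suc zero)) (>⇒≉ 0<b₀)
  ... | ρ , root = inj₂ (ρ , [] , b₀ , Qb₀ , 0<b₀ , root)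
  least-parameter 0≤Q Qb₀ 0<b₀ {b ∷ M} (Qb ∷ QM) with least-parameter 0≤Q Qb₀ 0<b₀ QM
  ... | inj₁ infeasible = inj₁ infeasible
  ... | inj₂ (ρ , solves , tight) with 0# ≤? b · affine ρ
  ...   | yes holds = inj₂ (ρ , holds ∷ solves , tight)
  ...   | no fails with 0# <? b zero
  -- The slope is 0, so failure at one `ρ` means that the constant term is negative and every `ρ`
  -- fails.
  ...     | no 0≮b = inj₁ (b , Qb , ≮⇒≥ 0≮b , (begin-strict
              b (suc zero)              ≈⟨ +-identityˡ _ ⟨
              0# + b (suc zero)         ≈⟨ +-congʳ (trans (*-congʳ (≤-antisym (≮⇒≥ 0≮b) (0≤Q Qb))) (zeroˡ ρ)) ⟨
              b zero * ρ + b (suc zero) ≈⟨ ·-affine b ρ ⟨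
              b · affine ρ              <⟨ ≰⇒> fails ⟩
              0#                        ∎))
  ...     | yes 0<b with linear-root (b zero) (b (suc zero)) (>⇒≉ 0<b)
  ...       | σ , root = inj₂ (σ , ≤-reflexive (sym (trans (·-affine b σ) root)) ∷ σ-solves , b , Qb , 0<b , root)
    where
    ρ≤σ : ρ ≤ σ
    ρ≤σ = *-cancelˡ-≤ 0<b (+-cancelʳ-≤ (b (suc zero)) (begin
      b zero * ρ + b (suc zero) ≈⟨ ·-affine b ρ ⟨
      b · affine ρ              ≤⟨ proj₁ (≰⇒> fails) ⟩
      0#                        ≈⟨ root ⟨
      b zero * σ + b (suc zero) ∎))
    ·-affine-mono : ∀ d → 0# ≤ d zero → d · affine ρ ≤ d · affine σ
    ·-affine-mono d 0≤d = +-monoˡ-≤ _ _ _ (*-monoʳ-≤ 0≤d ρ≤σ)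
    σ-solves : All (λ d → 0# ≤ d · affine σ) M
    σ-solves = All.zipWith (λ {d} (Qd , holds) → ≤-trans holds (·-affine-mono d (0≤Q Qd))) (QM , solves)

  -- The linear system of a rounding scheme and its minimax alternative.

  module _ {n m} (x : Vector Carrier n) (y : Fin m → Vector Carrier n) where

    -- Weighting the inequalities Σⱼ pⱼ yⱼ ≤ ρ x by w forces 0 ≤ v · p + b · (ρ , 1)
    -- on every probability vector p.
    Forced : Pred (Inequality m 2) (c ⊔ ℓ₁ ⊔ ℓ₂)
    Forced (v , b) = ∃ λ w → NonNegative w × b zero ≈ w · x × ∀ j → 0# ≤ b (suc zero) + (v j + w · y j)

    Forced-cone : IsConvexCone Forced
    Forced-cone {α} {β} {v , b} {v′ , b′} {v″ , b″} 0≤α 0≤β (w , 0≤w , b≈ , bound) (w′ , 0≤w′ , b′≈ , bound′) eq₁ eq₂ =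
        combination α w β w′
      , (λ i → 0≤+ (*-nonNegative _ _ 0≤α (0≤w i)) (*-nonNegative _ _ 0≤β (0≤w′ i)))
      , trans (eq₂ zero) (trans (+-cong (*-congˡ b≈) (*-congˡ b′≈)) (sym (·-combination α w β w′ x)))
      , λ j → begin
          0# ≤⟨ 0≤+ (*-nonNegative _ _ 0≤α (bound j)) (*-nonNegative _ _ 0≤β (bound′ j)) ⟩
          α * (b (suc zero) + (v j + w · y j)) + β * (b′ (suc zero) + (v′ j + w′ · y j))
            ≈⟨ regroup α β _ _ _ _ _ _ ⟩
          combination α b β b′ (suc zero) + (combination α v β v′ j + (α * (w · y j) + β * (w′ · y j)))
            ≈⟨ +-cong (eq₂ (suc zero)) (+-cong (eq₁ j) (·-combination α w β w′ (y j))) ⟨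
          b″ (suc zero) + (v″ j + combination α w β w′ · y j) ∎
      where
      regroup : ∀ α β b v d b′ v′ d′ → α * (b + (v + d)) + β * (b′ + (v′ + d′)) ≈
                α * b + β * b′ + (α * v + β * v′ + (α * d + β * d′))
      regroup = solve 8 (λ α β b v d b′ v′ d′ → α :* (b :+ (v :+ d)) :+ β :* (b′ :+ (v′ :+ d′)) :=
                α :* b :+ β :* b′ :+ (α :* v :+ β :* v′ :+ (α :* d :+ β :* d′))) refl

    pair : Carrier → Carrier → Vector Carrier 2
    pair a b zero    = a
    pair a b (suc _) = b

    nonNegativity : Fin m → Inequality m 2
    nonNegativity j = unit j , pair 0# 0#

    -- Normalisation is split into two opposite inequalities, the form that elimination handles.
    sum≥1 sum≤1 : Inequality m 2
    sum≥1 = (λ _ → 1#) , pair 0# (- 1#)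
    sum≤1 = (λ _ → - 1#) , pair 0# 1#

    domination : Fin n → Inequality m 2
    domination i = (λ j → - y j i) , pair (x i) 0#

    system : List (Inequality m 2)
    system = sum≥1 ∷ sum≤1 ∷ map nonNegativity (allFin m) ++ map domination (allFin n)

    -- The weight is 0 for normalisation and nonnegativity, and `unit i` for the domination in
    -- coordinate `i`.
    system⊆Forced : All Forced system
    system⊆Forced =
        ((λ _ → 0#) , (λ _ → ≤-refl) , sym (·-zeroˡ x) , λ j → ≤-reflexive (sym
          (trans (+-congˡ (trans (+-congˡ (·-zeroˡ (y j))) (+-identityʳ 1#))) (-‿inverseˡ 1#))))
      ∷ ((λ _ → 0#) , (λ _ → ≤-refl) , sym (·-zeroˡ x) , λ j → ≤-reflexive (sym
          (trans (+-congˡ (trans (+-congˡ (·-zeroˡ (y j))) (+-identityʳ (- 1#)))) (-‿inverseʳ 1#))))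
      ∷ Allₚ.++⁺
          (Allₚ.map⁺ {xs = allFin m} {f = nonNegativity} (All.tabulate λ {k} _ →
            (λ _ → 0#) , (λ _ → ≤-refl) , sym (·-zeroˡ x) , λ j →
              0≤+ ≤-refl (0≤+ (0≤unit k j) (≤-reflexive (sym (·-zeroˡ (y j)))))))
          (Allₚ.map⁺ {xs = allFin n} {f = domination} (All.tabulate λ {i} _ →
            unit i , 0≤unit i , sym (unit-· i x) , λ j →
              0≤+ ≤-refl (≤-reflexive (sym (trans (+-congˡ (unit-· i (y j))) (-‿inverseˡ (y j i)))))))

    -- Bounding the mean vector coordinatewise by `ρ` times `x` bounds the expected cost for all
    -- nonnegative weights at once.
    record Dominated (ρ : Carrier) : Set (c ⊔ ℓ₁ ⊔ ℓ₂) where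
      field
        probability : Vector Carrier m
        nonNegative : NonNegative probability
        normalised  : sum probability ≈ 1#
        dominated   : ∀ i → sum (λ j → probability j * y j i) ≤ ρ * x i

    system-solution : ∀ ρ p → All ((p , affine ρ) ⊨_) system → Dominated ρ
    system-solution ρ p (≥1 ∷ ≤1 ∷ others) = record
      { probability = p
      ; nonNegative = λ j → ≤-respʳ-≈
          (trans (+-cong (unit-· j p) (trans (·-affine (pair 0# 0#) ρ) (trans (+-identityʳ _) (zeroˡ ρ)))) (+-identityʳ (p j)))
          (All.lookup others (∈-++⁺ˡ (∈-map⁺ nonNegativity (∈-allFin j))))
      ; normalised = ≤-antisym
          (0≤y-x⇒x≤y (≤-respʳ-≈ (trans (+-cong
              (trans (sym (*-distribˡ-sum (- 1#) p)) (-1*x≈-x (sum p)))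
              (constant 1#)) (+-comm _ _)) ≤1))
          (0≤y-x⇒x≤y (≤-respʳ-≈ (+-cong (sum-cong-≋ (λ j → *-identityˡ (p j))) (constant (- 1#))) ≥1))
      ; dominated = λ i → 0≤y-x⇒x≤y (≤-respʳ-≈ (trans (+-cong
            (neg-sum (λ j → y j i))
            (trans (·-affine (pair (x i) 0#) ρ) (trans (+-identityʳ _) (*-comm (x i) ρ)))) (+-comm _ _))
          (All.lookup others (∈-++⁺ʳ (map nonNegativity (allFin m)) (∈-map⁺ domination (∈-allFin i)))))
      }
      where
      constant : ∀ a → pair 0# a · affine ρ ≈ a
      constant a = trans (·-affine (pair 0# a) ρ) (trans (+-congʳ (zeroˡ ρ)) (+-identityˡ a))
      neg-sum : ∀ v → (λ j → - v j) · p ≈ - sum (λ j → p j * v j)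
      neg-sum v = begin-equality
        (λ j → - v j) · p              ≈⟨ sum-cong-≋ (λ j → trans (sym (-‿distribˡ-* (v j) (p j))) (trans (-‿cong (*-comm (v j) (p j))) (sym (-1*x≈-x (p j * v j))))) ⟩
        sum (λ j → - 1# * (p j * v j)) ≈⟨ *-distribˡ-sum (- 1#) (λ j → p j * v j) ⟨
        - 1# * sum (λ j → p j * v j)   ≈⟨ -1*x≈-x _ ⟩
        - sum (λ j → p j * v j)        ∎

    private
      0≤b+d⇒-b≤d : ∀ {b d} → 0# ≤ b + (0# + d) → - b ≤ d
      0≤b+d⇒-b≤d {b} {d} 0≤b+d = +-cancelʳ-≤ b (begin
        - b + b      ≈⟨ -‿inverseˡ b ⟩
        0#           ≤⟨ 0≤b+d ⟩
        b + (0# + d) ≈⟨ +-congˡ (+-identityˡ d) ⟩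
        b + d        ≈⟨ +-comm b d ⟩
        d + b        ∎)

    -- After elimination each inequality on `ρ` has slope `w · x` for some weight `w` from `Forced`,
    -- so `least-parameter` applies; the weight behind its tight or infeasible inequality is the
    -- certificate.
    minimax : NonNegative x → (∀ j → NonNegative (y j)) → 0# < (λ _ → 1#) · x →
      (∃ λ ρ → Dominated ρ × ∃ λ w → NonNegative w × 0# < w · x × ∀ j → ρ * (w · x) ≤ w · y j) ⊎
      (∃ λ w → NonNegative w × w · x ≈ 0# × ∃ λ δ → 0# < δ × ∀ j → δ ≤ w · y j)
    minimax 0≤x 0≤y 0<x with eliminate (λ {α} {β} {u} {v} {w} → Forced-cone {α} {β} {u} {v} {w}) system⊆Forced
    ... | M , M⊆ , extend
      with least-parameter (λ { (w , 0≤w , b≈ , _) → ≤-respʳ-≈ (sym b≈) (0≤· 0≤w 0≤x) })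
             -- The all-ones weight supplies a forced inequality of positive slope; its constant
             -- term 0 is allowed because all costs are nonnegative.
             {pair ((λ _ → 1#) · x) 0#}
             ((λ _ → 1#) , (λ _ → 0≤1) , refl , λ j → 0≤+ ≤-refl (0≤+ ≤-refl (0≤· (λ _ → 0≤1) (0≤y j))))
             0<x M⊆
    ... | inj₁ (b , (w , 0≤w , b≈ , bound) , b≤0 , b<0) = inj₂
          (w , 0≤w , ≤-antisym (≤-respˡ-≈ b≈ b≤0) (0≤· 0≤w 0≤x) , - b (suc zero) , x<0⇒0<-x b<0 , λ j → 0≤b+d⇒-b≤d (bound j))
    ... | inj₂ (ρ , solves , b , (w , 0≤w , b≈ , bound) , 0<b , root) = inj₁
          (ρ , (let (p , p-solves) = extend (affine ρ) solves in system-solution ρ p p-solves)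
             , w , 0≤w , <-respʳ-≈ b≈ 0<b , λ j → begin
                 ρ * (w · x)    ≈⟨ trans (*-comm ρ _) (*-congʳ (sym b≈)) ⟩
                 b zero * ρ     ≈⟨ +-inverseˡ-unique _ _ root ⟩
                 - b (suc zero) ≤⟨ 0≤b+d⇒-b≤d (bound j) ⟩
                 w · y j        ∎)

-- Performance ratio and integrality gap as extended reals.

module Ratios {c ℓ₁ ℓ₂} (ℝ : RealNumbers c ℓ₁ ℓ₂) where
  open OrderedField ℝ
  open Rounding ℝ using (SolutionSet; RoundingScheme; 𝔼; Cost; Admissible; IsPerformanceRatio; IsIntegralityGap)
  open Game ℝ
  open Extrema _≤_ using (≤±-trans; ⊥±≤_; _≤⊤±; [≤]-injective) renaming ([_] to [_]≤)

  [k]≰⊥± : ∀ {k} → ¬ ([ k ] ≤± ⊥±)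
  [k]≰⊥± Supremum.[ () ]

  module _ {n} (S : SolutionSet n) where
    open SolutionSet S

    minimum-cost : ∀ w → ∃ λ m → IsInfimum _≤_ (Cost S w) m × ∃ λ j → m ≡ w · element j
    minimum-cost w with minimum size-nonZero (λ j → w · element j)
    ... | j , least = w · element j
      , ((λ { _ (i , ≡.refl) → least i }) , λ _ lower → lower _ (j , ≡.refl)) , j , ≡.refl

    point-mass : Fin size → RoundingScheme S
    point-mass j = record
      { probability = unit j
      ; nonNegative = 0≤unit j
      ; normalised  = trans (sum-cong-≋ (λ i → sym (*-identityʳ (unit j i)))) (unit-· j (λ _ → 1#))
      }

    lower-bound≤𝔼 : ∀ (P : RoundingScheme S) w {m} → (∀ j → m ≤ w · element j) → m ≤ 𝔼 P (w ·_)
    lower-bound≤𝔼 P w {m} m≤ = begin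
      m                  ≈⟨ *-identityˡ m ⟨
      1# * m             ≈⟨ *-congʳ normalised ⟨
      sum p * m          ≈⟨ *-distribʳ-sum m p ⟩
      sum (λ j → p j * m) ≤⟨ ·-monoʳ-≤ 0≤p m≤ ⟩
      𝔼 P (w ·_)         ∎
      where open RoundingScheme P using (normalised) renaming (probability to p; nonNegative to 0≤p)

  module _ {n} (x : Vector Carrier n) (S : SolutionSet n) where
    open SolutionSet S

    PerformanceValue : RoundingScheme S → Pred (Carrier ±) (c ⊔ ℓ₁ ⊔ ℓ₂)
    PerformanceValue P r = ∃ λ w → Admissible x w × r ≡ [ 𝔼 P (w ·_) ÷ (w · x) ]

    GapValue : Pred (Carrier ±) (c ⊔ ℓ₁ ⊔ ℓ₂)
    GapValue r = ∃ λ w → Admissible x w × ∃ λ m → IsInfimum _≤_ (Cost S w) m × r ≡ [ m ÷ (w · x) ]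

    -- A minimum cost is at most an expected cost, so every upper bound of the performance values
    -- also bounds the gap values. The two hypotheses then pin both suprema to `ρ`.
    squeeze : ∀ P {ρ} → UpperBound _≤±_ (PerformanceValue P) ρ →
              (∀ u → UpperBound _≤±_ GapValue u → ρ ≤± u) →
              IsPerformanceRatio x P ρ × IsIntegralityGap x S ρ
    squeeze P {ρ} upper least =
        (upper , λ u bound → least u (gap-bound bound)) , (gap-bound upper , least)
      where
      gap-bound : ∀ {u} → UpperBound _≤±_ (PerformanceValue P) u → UpperBound _≤±_ GapValue u
      gap-bound bound _ (w , adm@(_ , 0<w·x) , m , inf , ≡.refl) = ≤±-trans ≤-trans
        [ ÷-mono-≤ 0<w·x (lower-bound≤𝔼 S P w (λ j → proj₁ inf _ (j , ≡.refl))) ]≤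
        (bound _ (w , adm , ≡.refl))

    -- The infimum of the costs is attained at some element, so the gap value of this single weight
    -- is already at least `v`.
    witness≤gap : ∀ {w v} → Admissible x w → (∀ j → v * (w · x) ≤ w · element j) →
                  ∀ u → UpperBound _≤±_ GapValue u → [ v ] ≤± u
    witness≤gap {w} adm@(_ , 0<w·x) v≤ u bound with minimum-cost S w
    ... | m , inf , j , ≡.refl = ≤±-trans ≤-trans
      [ x*a≤y⇒x≤y÷a 0<w·x (v≤ j) ]≤ (bound _ (w , adm , _ , inf , ≡.refl))

    finite-case : ∀ ρ → Dominated x element ρ →
      (∃ λ w → NonNegative w × 0# < w · x × ∀ j → ρ * (w · x) ≤ w · element j) →
      Σ[ P ∈ RoundingScheme S ] Σ[ ρ ∈ Carrier ± ] IsPerformanceRatio x P ρ × IsIntegralityGap x S ρ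
    finite-case ρ D (w , 0≤w , 0<w·x , ρ≤) = P , [ ρ ] , squeeze P
      (λ { _ (w , (0≤w , 0<w·x) , ≡.refl) → [ x≤y*a⇒x÷a≤y 0<w·x (𝔼≤ w 0≤w) ]≤ })
      (witness≤gap (0≤w , 0<w·x) ρ≤)
      where
      open Dominated D renaming (probability to p)
      P : RoundingScheme S
      P = record { probability = p ; nonNegative = Dominated.nonNegative D ; normalised = normalised }
      𝔼≤ : ∀ w → NonNegative w → 𝔼 P (w ·_) ≤ ρ * (w · x)
      𝔼≤ w 0≤w = begin
        sum (λ j → p j * (w · element j))
          ≈⟨ sum-cong-≋ (λ j → *-distribˡ-sum (p j) (λ i → w i * element j i)) ⟩
        sum (λ j → sum (λ i → p j * (w i * element j i)))
          -- Exchanging the sums turns the expected cost into the cost of the mean vector, to which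
          -- `dominated` applies.
          ≈⟨ ∑-comm (λ j i → p j * (w i * element j i)) ⟩
        sum (λ i → sum (λ j → p j * (w i * element j i)))
          ≈⟨ sum-cong-≋ (λ i → trans (sum-cong-≋ (λ j → swap (p j) (w i) (element j i)))
                                     (sym (*-distribˡ-sum (w i) (λ j → p j * element j i)))) ⟩
        w · (λ i → sum (λ j → p j * element j i))
          ≤⟨ ·-monoʳ-≤ 0≤w dominated ⟩
        w · (λ i → ρ * x i)
          ≈⟨ sum-cong-≋ (λ i → swap (w i) ρ (x i)) ⟩
        sum (λ i → ρ * (w i * x i))
          ≈⟨ *-distribˡ-sum ρ (λ i → w i * x i) ⟨
        ρ * (w · x) ∎
        where
        swap : ∀ a b d → a * (b * d) ≈ b * (a * d)
        swap = solve 3 (λ a b d → a :* (b :* d) := b :* (a :* d)) refl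

    -- Serves where the common value is infinite, so that any scheme will do; `minimum` of a
    -- constant merely extracts an index.
    some-scheme : RoundingScheme S
    some-scheme = point-mass S (proj₁ (minimum size-nonZero (λ _ → 0#)))

    -- Adding a large multiple of w to the all-ones weight leaves the cost of x
    -- unchanged while every solution becomes arbitrarily expensive.
    infinite-case : 0# < (λ _ → 1#) · x →
      (∃ λ w → NonNegative w × w · x ≈ 0# × ∃ λ δ → 0# < δ × ∀ j → δ ≤ w · element j) →
      IsPerformanceRatio x some-scheme ⊤± × IsIntegralityGap x S ⊤±
    infinite-case 0<s (w , 0≤w , w·x≈0 , δ , 0<δ , δ≤) = squeeze some-scheme (λ r _ → r ≤⊤±) ⊤±≤
      where
      ones : Vector Carrier n
      ones _ = 1#
      s = ones · x

      weight : Carrier → Vector Carrier n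
      weight k = combination 1# ones k w

      weight·x : ∀ k → weight k · x ≈ s
      weight·x k = begin-equality
        weight k · x           ≈⟨ ·-combination 1# ones k w x ⟩
        1# * s + k * (w · x)   ≈⟨ +-cong (*-identityˡ s) (trans (*-congˡ w·x≈0) (zeroʳ k)) ⟩
        s + 0#                 ≈⟨ +-identityʳ s ⟩
        s                      ∎

      ≤gap : ∀ v → 0# ≤ v → ∀ u → UpperBound _≤±_ GapValue u → [ v ] ≤± u
      ≤gap v 0≤v = witness≤gap
        ((λ i → 0≤+ (*-nonNegative _ _ 0≤1 0≤1) (*-nonNegative _ _ 0≤k (0≤w i))) , <-respʳ-≈ (sym (weight·x k)) 0<s)
        λ j → begin
          v * (weight k · x)                         ≈⟨ *-congˡ (weight·x k) ⟩
          v * s                                      ≈⟨ k*δ≈v*s ⟨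
          k * δ                                      ≤⟨ *-monoʳ-≤ 0≤k (δ≤ j) ⟩
          k * (w · element j)                        ≈⟨ +-identityˡ _ ⟨
          0# + k * (w · element j)                   ≤⟨ +-monoˡ-≤ _ _ _ (*-nonNegative _ _ 0≤1 (0≤· (λ _ → 0≤1) (nonNegative j))) ⟩
          1# * (ones · element j) + k * (w · element j) ≈⟨ ·-combination 1# ones k w (element j) ⟨
          weight k · element j                       ∎
        where
        -- Chosen so that the multiple of `w` alone costs at least `v * s` on every solution.
        k = v * s ÷ δ
        0≤k : 0# ≤ k
        0≤k = *-nonNegative _ _ (*-nonNegative _ _ 0≤v (proj₁ 0<s)) (0≤x⁻¹ 0<δ)
        k*δ≈v*s : k * δ ≈ v * s
        k*δ≈v*s = trans (*-assoc (v * s) (δ ⁻¹) δ)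
          (trans (*-congˡ (trans (*-comm (δ ⁻¹) δ) (⁻¹-inverseʳ δ (>⇒≉ 0<δ)))) (*-identityʳ (v * s)))

      ⊤±≤ : ∀ u → UpperBound _≤±_ GapValue u → ⊤± ≤± u
      ⊤±≤ ⊤±    _     = ⊤± ≤⊤±
      ⊤±≤ ⊥±    bound = contradiction (≤gap 0# ≤-refl ⊥± bound) [k]≰⊥±
      -- A finite bound `u` would be at least `1# + u`. Nonnegativity of `u` comes first, since
      -- `≤gap` takes only nonnegative values.
      ⊤±≤ [ u ] bound = contradiction 1≤0 1≰0
        where
        0≤u : 0# ≤ u
        0≤u = [≤]-injective (≤gap 0# ≤-refl [ u ] bound)
        1≤0 : 1# ≤ 0#
        1≤0 = +-cancelʳ-≤ u (begin
          1# + u ≤⟨ [≤]-injective (≤gap (1# + u) (0≤+ 0≤1 0≤u) [ u ] bound) ⟩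
          u      ≈⟨ +-identityˡ u ⟨
          0# + u ∎)

    -- Each entry of `x` is at most the entry sum, hence at most 0. No weight is admissible, and
    -- both suprema are over the empty set.
    zero-case : NonNegative x → ¬ (0# < (λ _ → 1#) · x) →
      IsPerformanceRatio x some-scheme ⊥± × IsIntegralityGap x S ⊥±
    zero-case 0≤x 0≮s = squeeze some-scheme
      (λ { _ (w , (0≤w , 0<w·x) , _) → contradiction (w·x≤0 w 0≤w) (<⇒≱ 0<w·x) })
      (λ u _ → ⊥±≤ u)
      where
      w·x≤0 : ∀ w → NonNegative w → w · x ≤ 0#
      w·x≤0 w 0≤w = ≤-respʳ-≈ (·-zeroʳ w) (·-monoʳ-≤ 0≤w λ i → ≤-trans (entry≤ones· 0≤x i) (≮⇒≥ 0≮s))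

theorem7p2 : {c ℓ₁ ℓ₂ : Level} (ℝ : RealNumbers c ℓ₁ ℓ₂) →
    let open RealNumbers ℝ
        open Rounding ℝ
    in (n : ℕ) (x : Vector Carrier n) → NonNegative x →
       (S : SolutionSet n) →
       Σ[ P ∈ RoundingScheme S ] Σ[ ρ ∈ Carrier ± ] IsPerformanceRatio x P ρ × IsIntegralityGap x S ρ
theorem7p2 ℝ n x 0≤x S with OrderedField._<?_ ℝ (RealNumbers.0# ℝ) (Rounding._·_ ℝ (λ _ → RealNumbers.1# ℝ) x)
... | no  0≮s = Ratios.some-scheme ℝ x S , ⊥± , Ratios.zero-case ℝ x S 0≤x 0≮s
... | yes 0<s with Game.minimax ℝ x (Rounding.SolutionSet.element S) 0≤x (Rounding.SolutionSet.nonNegative S) 0<s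
...   | inj₁ (ρ , D , certificate) = Ratios.finite-case ℝ x S ρ D certificate
...   | inj₂ certificate           = Ratios.some-scheme ℝ x S , ⊤± , Ratios.infinite-case ℝ x S 0<s certificate
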